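{- Each of the following families of games is pet and forced: Bishop on the set of all nonempty partitions; Pawn on the set of all rectangles; Rook on the set of all staircases; Queen on the set of all staircases; Knight on the set of all staircases.
   Context: A partition is a finite weakly decreasing sequence $\lambda=[\lambda_1,\ldots,\lambda_r]$ of positive integers; $[\,]$ is the empty partition, and $\mathbb Y^+$ is the set of nonempty partitions. For $i,j\ge 0$, $\lambda[i,j]=[\lambda_{i+1}-j,\lambda_{i+2}-j,\ldots]$ with trailing nonpositive entries removed. For a moveset $M\subseteq \mathbb Z_{\ge0}^2\setminus\{(0,0)\}$ and $\lambda\in\mathbb Y^+$, the impartial chess game $(M,\lambda)$ starts at $\lambda$, and from a position $\mu\in\mathbb Y^+$ a player may move to $\mu[i,j]$ for any $(i,j)\in M$ with $\mu[i,j]\ne[\,]$. The positions of $(M,\lambda)$ are the partitions reachable from $\lambda$ by zero or more moves. A position is terminal if it has no moves. Movesets: Pawn $\{(0,1),(1,1)\}$; Knight $\{(1,2),(2,1)\}$; Bishop $\{(k,k):k\ge1\}$; Rook $\{(k,0):k\ge1\}\cup\{(0,k):k\ge1\}$; Queen $\{(k,0):k\ge1\}\cup\{(0,k):k\ge1\}\cup\{(k,k):k\ge1\}$. Rectangles are the partitions $[c^r]$ ($c$ repeated $r$ times), $r,c\ge1$; staircases are the partitions $[k,k-1,\ldots,1]$, $k\ge1$. The Sprague-Grundy value of a position $p$ is $\mathrm{mex}$ of the Sprague-Grundy values of the positions reachable in one move ($0$ if $p$ is terminal), where $\mathrm{mex}(S)$ is the least nonnegative integer not in $S$. The misère Grundy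 value is defined by the same mex recursion at non-terminal positions, but terminal positions have value $1$. A position with Sprague-Grundy value $t$ and misère Grundy value $\ell$ is called a $(t,\ell)$-position. A game is forced if each move from a $(0,1)$-position results in a $(1,0)$-position and each move from a $(1,0)$-position results in a $(0,1)$-position. A game is pet if it has only $(0,1)$-positions, $(1,0)$-positions, and $(k,k)$-positions with $k\ge2$. For a moveset $M$ and a set $P\subseteq\mathbb Y^+$, the family $(M,P)$ has one of these properties if $(M,\lambda)$ has it for every $\lambda\in P$. -}

module Defs where

open import Data.Nat using (ℕ; suc; _∸_; _<_; _≥_; _>_; _>?_)
open import Data.Nat.Properties using (<-cmp; ∸-monoˡ-≤; ≤-irrelevant)
open import Data.List using (List; []; drop; map; filter; replicate; applyDownFrom)
open import Data.List.Relation.Unary.All as All using (All)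
import Data.List.Relation.Unary.All.Properties as All
open import Data.List.Relation.Unary.AllPairs as AllPairs using (AllPairs)
import Data.List.Relation.Unary.AllPairs.Properties as AllPairs
open import Data.Empty using (⊥-elim)
open import Data.Product using (_×_; _,_; ∃; ∃-syntax; ∃₂; proj₁; proj₂)
open import Data.Sum using (_⊎_; inj₁; inj₂)
open import Level using (0ℓ)
open import Relation.Binary.Construct.Closure.ReflexiveTransitive using (Star)
open import Relation.Binary.Definitions using (tri<; tri≈; tri>)
open import Relation.Binary.PropositionalEquality using (_≡_; _≢_; refl; sym; cong₂)
open import Relation.Nullary using (¬_)
open import Relation.Unary using (Pred; _∈_; _∉_; _∪_; ｛_｝)

record Partition : Set where
  constructor mkPartition
  field
    parts      : List ℕ
    decreasing : AllPairs _≥_ parts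
    positive   : All (_> 0) parts

open Partition public

partition-≡ : ∀ {p q} → parts p ≡ parts q → p ≡ q
partition-≡ {mkPartition ps d⁺ p⁺} {mkPartition _ d⁺′ p⁺′} refl =
  cong₂ (mkPartition ps) (AllPairs.irrelevant ≤-irrelevant d⁺ d⁺′)
                         (All.irrelevant ≤-irrelevant p⁺ p⁺′)

-- An entry λₐ - j is nonpositive exactly when the truncated λₐ ∸ j is zero,
-- and in a weakly decreasing sequence the zeros are trailing, so filtering
-- them out removes a final segment.
_[_,_] : Partition → ℕ → ℕ → Partition
p [ i , j ] = mkPartition
  (filter (_>? 0) shifted)
  (AllPairs.filter⁺ (_>? 0)
    (AllPairs.map⁺ (AllPairs.map (∸-monoˡ-≤ j) (AllPairs.drop⁺ i (decreasing p)))))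
  (All.all-filter (_>? 0) shifted)
  where
  shifted : List ℕ
  shifted = map (_∸ j) (drop i (parts p))

record 𝕐⁺ : Set where
  constructor mk𝕐⁺
  field
    partition : Partition
    .nonempty : parts partition ≢ []

open 𝕐⁺ public

record Moveset : Set₁ where
  field
    moves   : Pred (ℕ × ℕ) 0ℓ
    no-pass : (0 , 0) ∉ moves

open Moveset public

-- The result has type 𝕐⁺, so moves to the empty partition are excluded.
Move : Moveset → 𝕐⁺ → 𝕐⁺ → Set
Move M p q = ∃₂ λ i j → (i , j) ∈ moves M × partition q ≡ partition p [ i , j ]

-- Positions of the game (M , start).
Position : Moveset → 𝕐⁺ → Pred 𝕐⁺ 0ℓ
Position M start p = Star (Move M) start p

Terminal : Moveset → Pred 𝕐⁺ 0ℓ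
Terminal M p = ∀ q → ¬ Move M p q

-- Value M e p g: the mex recursion with terminal positions assigned e gives p
-- the value g.  It is an inductive relation because a moveset need not be
-- decidable.  In `mex`, every option has a value, g is the value of none of
-- them, and each smaller number is the value of some option.
data Value (M : Moveset) (e : ℕ) (p : 𝕐⁺) : ℕ → Set where
  terminal : Terminal M p → Value M e p e
  mex      : ∀ {g} → ∃ (Move M p) →
             (∀ q → Move M p q → ∃[ v ] (v ≢ g × Value M e q v)) →
             (∀ v → v < g → ∃[ q ] (Move M p q × Value M e q v)) →
             Value M e p g

value-unique : ∀ {M e p g h} → Value M e p g → Value M e p h → g ≡ h
value-unique (terminal _) (terminal _) = refl
value-unique (terminal t) (mex (q , m) _ _) = ⊥-elim (t q m)
value-unique (mex (q , m) _ _) (terminal t) = ⊥-elim (t q m)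
value-unique {g = g} {h} (mex _ avoid hit) (mex _ avoid′ hit′) with <-cmp g h
... | tri≈ _ g≡h _ = g≡h
... | tri< g<h _ _ =
  let x = hit′ g g<h ; y = avoid (proj₁ x) (proj₁ (proj₂ x))
  in ⊥-elim (proj₁ (proj₂ y) (value-unique (proj₂ (proj₂ y)) (proj₂ (proj₂ x))))
... | tri> _ _ h<g =
  let x = hit h h<g ; y = avoid′ (proj₁ x) (proj₁ (proj₂ x))
  in ⊥-elim (proj₁ (proj₂ y) (sym (value-unique (proj₂ (proj₂ x)) (proj₂ (proj₂ y)))))

SpragueGrundy : Moveset → 𝕐⁺ → ℕ → Set
SpragueGrundy M = Value M 0

MisèreGrundy : Moveset → 𝕐⁺ → ℕ → Set
MisèreGrundy M = Value M 1

⟨_,_⟩-position : ℕ → ℕ → Moveset → Pred 𝕐⁺ 0ℓ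
⟨ t , l ⟩-position M p = SpragueGrundy M p t × MisèreGrundy M p l

record Forced (M : Moveset) (start : 𝕐⁺) : Set where
  field
    from⟨0,1⟩ : ∀ p q → Position M start p → ⟨ 0 , 1 ⟩-position M p →
                Move M p q → ⟨ 1 , 0 ⟩-position M q
    from⟨1,0⟩ : ∀ p q → Position M start p → ⟨ 1 , 0 ⟩-position M p →
                Move M p q → ⟨ 0 , 1 ⟩-position M q

Pet : Moveset → 𝕐⁺ → Set
Pet M start = ∀ p → Position M start p →
  ⟨ 0 , 1 ⟩-position M p
  ⊎ ⟨ 1 , 0 ⟩-position M p
  ⊎ ∃[ k ] (k ≥ 2 × ⟨ k , k ⟩-position M p)

Family : (Moveset → 𝕐⁺ → Set) → Moveset → Pred 𝕐⁺ 0ℓ → Set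
Family Property M P = ∀ start → start ∈ P → Property M start

Pawn : Moveset
Pawn .moves = ｛ (0 , 1) ｝ ∪ ｛ (1 , 1) ｝
Pawn .no-pass (inj₁ ())
Pawn .no-pass (inj₂ ())

Knight : Moveset
Knight .moves = ｛ (1 , 2) ｝ ∪ ｛ (2 , 1) ｝
Knight .no-pass (inj₁ ())
Knight .no-pass (inj₂ ())

vertical horizontal diagonal : Pred (ℕ × ℕ) 0ℓ
vertical   m = ∃[ k ] (k ≥ 1 × m ≡ (k , 0))
horizontal m = ∃[ k ] (k ≥ 1 × m ≡ (0 , k))
diagonal   m = ∃[ k ] (k ≥ 1 × m ≡ (k , k))

Bishop : Moveset
Bishop .moves = diagonal
Bishop .no-pass (_ , () , refl)

Rook : Moveset
Rook .moves = vertical ∪ horizontal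
Rook .no-pass (inj₁ (_ , () , refl))
Rook .no-pass (inj₂ (_ , () , refl))

Queen : Moveset
Queen .moves = vertical ∪ horizontal ∪ diagonal
Queen .no-pass (inj₁ (_ , () , refl))
Queen .no-pass (inj₂ (inj₁ (_ , () , refl)))
Queen .no-pass (inj₂ (inj₂ (_ , () , refl)))

Rectangle : Pred 𝕐⁺ 0ℓ
Rectangle p = ∃₂ λ r c → r ≥ 1 × c ≥ 1 × parts (partition p) ≡ replicate r c

-- applyDownFrom suc k is [k, k-1, …, 1].
Staircase : Pred 𝕐⁺ 0ℓ
Staircase p = ∃[ k ] (k ≥ 1 × parts (partition p) ≡ applyDownFrom suc k)

{-# OPTIONS --safe #-}

-- Each of these games is bisimilar to a game on ℕ: Bishop, Rook and Queen to
-- Nim, where n moves to every m < n (a Bishop's n is the number of its moves,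
-- a Rook or Queen starts from the staircase [n + 1, …, 1]), and Pawn and Knight
-- to the game where n moves only to n - d, with d = 1 and d = 3.  In both
-- games on ℕ a number with Grundy value below 2 moves only to such numbers.
-- This makes the misère values arise from the Sprague-Grundy values by
-- exchanging 0 and 1.
module Submission where

open import Defs
open import Data.Empty using (⊥-elim-irr)
open import Data.List using (List; []; _∷_; length; drop; map; filter; replicate; applyDownFrom)
open import Data.List.Properties
  using (drop-drop; drop-map; drop-[]; map-id; map-∘; map-cong; map-replicate; filter-all; filter-none;
         filter-accept; filter-reject; length-filter; length-map)
open import Data.List.Relation.Unary.All as All using ()
import Data.List.Relation.Unary.All.Properties as All
open import Data.List.Relation.Unary.AllPairs as AllPairs using (AllPairs; []; _∷_)
import Data.List.Relation.Unary.AllPairs.Properties as AllPairs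
open import Data.Nat
open import Data.Nat.DivMod using (_/_; m<n⇒m/n≡0; m/n≡1+[m∸n]/n)
open import Data.Nat.Induction using (<-wellFounded)
open import Data.Nat.Properties
open import Data.Product using (_×_; _,_; ∃; ∃-syntax; ∃₂; proj₁; proj₂; map₂)
open import Data.Sum using (inj₁; inj₂)
open import Function using (_∘_; id)
open import Induction.WellFounded using (Acc; acc)
open import Level using (0ℓ)
open import Relation.Binary using (Rel)
open import Relation.Binary.Construct.Closure.ReflexiveTransitive using (Star; ε; _◅_)
open import Relation.Binary.PropositionalEquality hiding ([_])
open import Relation.Nullary using (¬_; Dec; yes; no; contradiction)
open import Relation.Unary using (Pred; _∈_; _⊆_; U)

-- Transfer of game values from games on ℕ.

parts≢[] : ∀ p → parts (partition p) ≢ []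
parts≢[] (mk𝕐⁺ _ ne) eq = ⊥-elim-irr (ne eq)

-- `Ranked` is a relation, so partitions outside a family may have no rank at all. Since `forth`
-- ranks the result of every move, a family of ranked partitions is closed under moves.
record Simulates (M : Moveset) (_⇝_ : Rel ℕ 0ℓ) (Ranked : 𝕐⁺ → ℕ → Set) : Set where
  field
    forth : ∀ {n} p q → Ranked p n → Move M p q → ∃[ m ] (n ⇝ m × Ranked q m)
    back  : ∀ {n m} p → Ranked p n → n ⇝ m → ∃[ q ] (Move M p q × Ranked q m)

-- `avoids` and `attains` are the two halves of the mex condition on `g`. `option?` decides which
-- constructor of `Value` applies.
record TameGrundy (_⇝_ : Rel ℕ 0ℓ) (g : ℕ → ℕ) : Set where
  field
    descends : ∀ {n m} → n ⇝ m → m < n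
    option?  : ∀ n → Dec (∃ (n ⇝_))
    avoids   : ∀ {n m} → n ⇝ m → g m ≢ g n
    attains  : ∀ {n v} → v < g n → ∃[ m ] (n ⇝ m × g m ≡ v)
    tame     : ∀ {n m} → n ⇝ m → g n < 2 → g m < 2

swap₀₁ : ℕ → ℕ
swap₀₁ 0 = 1
swap₀₁ 1 = 0
swap₀₁ n = n

swap₀₁-involutive : ∀ n → swap₀₁ (swap₀₁ n) ≡ n
swap₀₁-involutive 0             = refl
swap₀₁-involutive 1             = refl
swap₀₁-involutive (suc (suc _)) = refl

swap₀₁-injective : ∀ {m n} → swap₀₁ m ≡ swap₀₁ n → m ≡ n
swap₀₁-injective {m} {n} eq =
  trans (sym (swap₀₁-involutive m)) (trans (cong swap₀₁ eq) (swap₀₁-involutive n))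

-- Exchanging 0 and 1 permutes the numbers below any bound that is at least 2, so a mex of at least
-- 2 survives the exchange.
swap₀₁-<2+ : ∀ {v k} → v < 2 + k → swap₀₁ v < 2 + k
swap₀₁-<2+ {0}           _   = s≤s (s≤s z≤n)
swap₀₁-<2+ {1}           _   = s≤s z≤n
swap₀₁-<2+ {suc (suc _)} v<k = v<k

module _ {M _⇝_ Ranked} (simulates : Simulates M _⇝_ Ranked)
         {g} (grundy : TameGrundy _⇝_ g) where
  open Simulates simulates
  open TameGrundy grundy

  -- Induction on the rank, for a general `γ`: it serves `g` with terminal value 0 and `swap₀₁ ∘ g`
  -- with terminal value 1. Attainment presupposes an option because a terminal position of misère
  -- value 1 has none of value 0.
  transfer-value : ∀ {e} (γ : ℕ → ℕ) →
    (∀ {n} → ¬ ∃ (n ⇝_) → γ n ≡ e) →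
    (∀ {n m} → n ⇝ m → γ m ≢ γ n) →
    (∀ {n v} → ∃ (n ⇝_) → v < γ n → ∃[ m ] (n ⇝ m × γ m ≡ v)) →
    ∀ {n} p → Ranked p n → Value M e p (γ n)
  transfer-value {e} γ γ-terminal γ-avoids γ-attains p r = go p (<-wellFounded _) r
    where
    go : ∀ {n} p → Acc _<_ n → Ranked p n → Value M e p (γ n)
    go {n} p (acc rec) r with option? n
    ... | no stuck = subst (Value M e p) (sym (γ-terminal stuck))
          (terminal λ q mv → stuck (map₂ proj₁ (forth p q r mv)))
    ... | yes o@(_ , n⇝o) = mex (map₂ proj₁ (back p r n⇝o)) avoid hit
      where
      avoid : ∀ q → Move M p q → ∃[ v ] (v ≢ γ n × Value M e q v)
      avoid q mv = let m , n⇝m , r′ = forth p q r mv in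
        γ m , γ-avoids n⇝m , go q (rec (descends n⇝m)) r′

      hit : ∀ v → v < γ n → ∃[ q ] (Move M p q × Value M e q v)
      hit v v<γn =
        let m , n⇝m , γm≡v = γ-attains o v<γn
            q , mv , r′ = back p r n⇝m
        in q , mv , subst (Value M e q) γm≡v (go q (rec (descends n⇝m)) r′)

  terminal-zero : ∀ {n} → ¬ ∃ (n ⇝_) → g n ≡ 0
  terminal-zero stuck = n≤0⇒n≡0 (≮⇒≥ λ 0<gn → stuck (map₂ proj₁ (attains 0<gn)))

  -- Tameness bounds the value of the option by 1, and `avoids` rules out 0.
  zero⇝one : ∀ {n m} → n ⇝ m → g n ≡ 0 → g m ≡ 1
  zero⇝one {n} {m} n⇝m gn≡0 with g m | avoids n⇝m | tame n⇝m (subst (_< 2) (sym gn≡0) z<s)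
  ... | 0           | gm≢gn | _              = contradiction (sym gn≡0) gm≢gn
  ... | 1           | _     | _              = refl
  ... | suc (suc _) | _     | s≤s (s≤s ())

  one⇝zero : ∀ {n m} → n ⇝ m → g n ≡ 1 → g m ≡ 0
  one⇝zero {n} {m} n⇝m gn≡1 with g m | avoids n⇝m | tame n⇝m (subst (_< 2) (sym gn≡1) (s<s z<s))
  ... | 0           | _     | _              = refl
  ... | 1           | gm≢gn | _              = contradiction (sym gn≡1) gm≢gn
  ... | suc (suc _) | _     | s≤s (s≤s ())

  swap₀₁-attains : ∀ {n v} → ∃ (n ⇝_) → v < swap₀₁ (g n) → ∃[ m ] (n ⇝ m × swap₀₁ (g m) ≡ v)
  swap₀₁-attains {n} {v} (m , n⇝m) v< with g n in eq
  -- Here the misère value is 1, so an option of misère value 0 is required; by tameness every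
  -- option has Grundy value 1 and will do. Grundy value 1 becomes 0, below which nothing must be
  -- attained.
  swap₀₁-attains (m , n⇝m) (s≤s z≤n) | 0 = m , n⇝m , cong swap₀₁ (zero⇝one n⇝m eq)
  swap₀₁-attains {v = v} _ v<        | suc (suc _) =
    let m , n⇝m , gm≡ = attains (subst (swap₀₁ v <_) (sym eq) (swap₀₁-<2+ v<))
    in m , n⇝m , trans (cong swap₀₁ gm≡) (swap₀₁-involutive v)

  ranked-position : ∀ {n} p → Ranked p n → ⟨ g n , swap₀₁ (g n) ⟩-position M p
  ranked-position p r =
    transfer-value g terminal-zero avoids (λ _ → attains) p r ,
    transfer-value (swap₀₁ ∘ g) (cong swap₀₁ ∘ terminal-zero)
      (λ n⇝m → avoids n⇝m ∘ swap₀₁-injective) swap₀₁-attains p r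

  ranked-positions : ∀ {n p q} → Ranked p n → Star (Move M) p q → ∃ (Ranked q)
  ranked-positions r ε                         = _ , r
  ranked-positions r (_◅_ {i = p} {j = q} mv ms) =
    ranked-positions (proj₂ (proj₂ (forth p q r mv))) ms

  ranked-pet : ∀ {start n} → Ranked start n → Pet M start
  ranked-pet r p ms with ranked-positions r ms
  ... | n , r′ with g n | ranked-position p r′
  ...   | 0           | pos = inj₁ pos
  ...   | 1           | pos = inj₂ (inj₁ pos)
  ...   | suc (suc k) | pos = inj₂ (inj₂ (2 + k , s≤s (s≤s z≤n) , pos))

  ranked-forced : ∀ {start n} → Ranked start n → Forced M start
  ranked-forced r = record
    { from⟨0,1⟩ = λ p q ms (sg , _) mv →
        let n , rₚ = ranked-positions r ms
            m , n⇝m , r′ = forth p q rₚ mv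
        -- Uniqueness of values gives `g n ≡ 0`, and then tameness leaves only `g m ≡ 1`.
        in subst (λ v → ⟨ v , swap₀₁ v ⟩-position M q)
             (zero⇝one n⇝m (value-unique (proj₁ (ranked-position p rₚ)) sg)) (ranked-position q r′)
    ; from⟨1,0⟩ = λ p q ms (sg , _) mv →
        let n , rₚ = ranked-positions r ms
            m , n⇝m , r′ = forth p q rₚ mv
        in subst (λ v → ⟨ v , swap₀₁ v ⟩-position M q)
             (one⇝zero n⇝m (value-unique (proj₁ (ranked-position p rₚ)) sg)) (ranked-position q r′)
    }

  pet×forced : ∀ {P : Pred 𝕐⁺ 0ℓ} → (∀ start → start ∈ P → ∃ (Ranked start)) →
               Family Pet M P × Family Forced M P
  pet×forced rank =
    (λ start s∈P → ranked-pet (proj₂ (rank start s∈P))) ,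
    (λ start s∈P → ranked-forced (proj₂ (rank start s∈P)))

-- Nim and repeated subtraction of a fixed number.

nim : TameGrundy _>_ id
nim = record
  { descends = id
  ; option?  = λ { zero → no λ () ; (suc n) → yes (n , n<1+n n) }
  ; avoids   = <⇒≢
  ; attains  = λ v<n → _ , v<n , refl
  ; tame     = <-trans
  }

alternate : ℕ → ℕ
alternate zero    = 0
alternate (suc n) = 1 ∸ alternate n

alternate<2 : ∀ n → alternate n < 2
alternate<2 zero    = z<s
alternate<2 (suc n) = s≤s (m∸n≤m 1 (alternate n))

alternate-suc : ∀ n → alternate n ≢ alternate (suc n)
alternate-suc n with alternate n
... | zero        = λ ()
... | suc m       = λ eq → contradiction (trans eq (0∸n≡0 m)) 1+n≢0

module _ (d : ℕ) .{{_ : NonZero d}} where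

  -- Play from `n` never branches and lasts `n / d` moves, so the Grundy value is the parity of that
  -- quotient. All values lie below 2, which makes the game tame.
  ladder : TameGrundy (λ n m → n ≡ d + m) (λ n → alternate (n / d))
  ladder = record
    { descends = λ { {m = m} refl → m<n+m m (>-nonZero⁻¹ d) }
    ; option?  = option?
    ; avoids   = λ { {m = m} refl eq → alternate-suc (m / d) (trans eq (cong alternate ([d+m]/d m))) }
    ; attains  = attains
    ; tame     = λ {_} {m} _ _ → alternate<2 (m / d)
    }
    where
    [d+m]/d : ∀ m → (d + m) / d ≡ suc (m / d)
    [d+m]/d m = trans (m/n≡1+[m∸n]/n (m≤m+n d m)) (cong (λ k → suc (k / d)) (m+n∸m≡n d m))

    option? : ∀ n → Dec (∃[ m ] n ≡ d + m)
    option? n with d ≤? n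
    ... | yes d≤n = yes (n ∸ d , sym (m+[n∸m]≡n d≤n))
    ... | no  d≰n = no λ { (m , refl) → d≰n (m≤m+n d m) }

    attains : ∀ {n v} → v < alternate (n / d) → ∃[ m ] (n ≡ d + m × alternate (m / d) ≡ v)
    attains {n} {v} v< with option? n
    -- Without an option `n < d`, so the quotient and the value are 0 and no `v` lies below.
    -- Otherwise `v < 1 ∸ alternate (m / d)` forces both `v` and `alternate (m / d)` to be 0.
    ... | no stuck = contradiction
            (subst (λ k → v < alternate k)
              (m<n⇒m/n≡0 (≰⇒> λ d≤n → stuck (n ∸ d , sym (m+[n∸m]≡n d≤n)))) v<)
            n≮0
    ... | yes (m , refl) = m , refl , below (subst (λ k → v < alternate k) ([d+m]/d m) v<)
      where
      below : ∀ {k v} → v < 1 ∸ k → k ≡ v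
      below {zero}        (s≤s z≤n) = refl
      below {suc k} {v}   v<        = contradiction (subst (v <_) (0∸n≡0 k) v<) n≮0

-- Staircases under Rook, Queen and Knight.

truncate : ℕ → List ℕ → List ℕ
truncate j xs = filter (_>? 0) (map (_∸ j) xs)

drop-applyDownFrom : ∀ {A : Set} (f : ℕ → A) i k →
                     drop i (applyDownFrom f k) ≡ applyDownFrom f (k ∸ i)
drop-applyDownFrom f zero    k       = refl
drop-applyDownFrom f (suc i) zero    = refl
drop-applyDownFrom f (suc i) (suc k) = drop-applyDownFrom f i k

truncate-staircase : ∀ j k → truncate j (applyDownFrom suc k) ≡ applyDownFrom suc (k ∸ j)
truncate-staircase j zero rewrite 0∸n≡0 j = refl
truncate-staircase j (suc k) with j ≤? k
... | yes j≤k rewrite +-∸-assoc 1 j≤k = cong (suc (k ∸ j) ∷_) (truncate-staircase j k)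
... | no  j≰k rewrite m≤n⇒m∸n≡0 (≰⇒> j≰k) =
  trans (truncate-staircase j k) (cong (applyDownFrom suc) (m≤n⇒m∸n≡0 (<⇒≤ (≰⇒> j≰k))))

-- The offset by one makes rank 0 the staircase `[1]`, since the empty partition is not a position.
StaircaseRank : 𝕐⁺ → ℕ → Set
StaircaseRank p n = parts (partition p) ≡ applyDownFrom suc (suc n)

staircase-rank : ∀ p → p ∈ Staircase → ∃ (StaircaseRank p)
staircase-rank _ (suc n , _ , eq) = n , eq

-- Dropping `i` rows and removing `j` columns each shorten a staircase by that amount, so only the
-- sum `i + j` matters. The two hypotheses match these sums with the steps of the game on ℕ.
staircase-simulates : ∀ {M} {_⇝_ : Rel ℕ 0ℓ} →
  (∀ {i j m} → (i , j) ∈ moves M → (i + j + m) ⇝ m) →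
  (∀ {n m} → n ⇝ m → ∃₂ λ i j → (i , j) ∈ moves M × n ≡ i + j + m) →
  Simulates M _⇝_ StaircaseRank
staircase-simulates {M} {_⇝_} sound complete = record { forth = forth ; back = back }
  where
  shift : ∀ p i j {k} → parts p ≡ applyDownFrom suc k →
          parts (p [ i , j ]) ≡ applyDownFrom suc (k ∸ (i + j))
  -- By definition the parts of `p [ i , j ]` are `truncate j (drop i (parts p))`.
  shift p i j {k} eq rewrite eq | drop-applyDownFrom suc i k | truncate-staircase j (k ∸ i) =
    cong (applyDownFrom suc) (∸-+-assoc k i j)

  forth : ∀ {n} p q → StaircaseRank p n → Move M p q → ∃[ m ] (n ⇝ m × StaircaseRank q m)
  forth {n} p q r (i , j , ij∈M , q≡) with i + j ≤? n
  ... | yes d≤n = n ∸ (i + j) , subst (_⇝ (n ∸ (i + j))) (m+[n∸m]≡n d≤n) (sound ij∈M) ,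
        trans (cong parts q≡) (trans (shift (partition p) i j r)
          (cong (applyDownFrom suc) (+-∸-assoc 1 d≤n)))
  -- A decrease of at least `suc n` would leave the empty partition, which no move reaches.
  ... | no  d≰n = contradiction (trans (cong parts q≡) (trans (shift (partition p) i j r)
          (cong (applyDownFrom suc) (m≤n⇒m∸n≡0 (≰⇒> d≰n))))) (parts≢[] q)

  back : ∀ {n m} p → StaircaseRank p n → n ⇝ m → ∃[ q ] (Move M p q × StaircaseRank q m)
  back {m = m} p r n⇝m with complete n⇝m
  ... | i , j , ij∈M , refl =
    mk𝕐⁺ (partition p [ i , j ]) (λ q≡[] → contradiction (trans (sym q-rank) q≡[]) λ ()) ,
    (i , j , ij∈M , refl) , q-rank
    where
    q-rank : parts (partition p [ i , j ]) ≡ applyDownFrom suc (suc m)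
    q-rank = trans (shift (partition p) i j r) (cong (applyDownFrom suc)
      (trans (+-∸-assoc 1 (m≤m+n (i + j) m)) (cong suc (m+n∸m≡n (i + j) m))))

-- Horizontal moves realize every decrease, and `no-pass` makes every move a strict decrease. This
-- covers Rook and Queen at once.
horizontal-staircase : ∀ {M} → horizontal ⊆ moves M → Simulates M _>_ StaircaseRank
horizontal-staircase {M} h⊆M = staircase-simulates sound
  (λ {_} {m} m<n → 0 , _ , h⊆M (_ , m<n⇒0<n∸m m<n , refl) , sym (m∸n+n≡m (<⇒≤ m<n)))
  where
  sound : ∀ {i j m} → (i , j) ∈ moves M → i + j + m > m
  sound {zero}  {zero}  0∈M = contradiction 0∈M (no-pass M)
  sound {zero}  {suc j} _   = m<n+m _ z<s
  sound {suc i} {j}     _   = m<n+m _ z<s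

knight-simulates : Simulates Knight (λ n m → n ≡ 3 + m) StaircaseRank
knight-simulates = staircase-simulates
  (λ { (inj₁ refl) → refl ; (inj₂ refl) → refl })
  (λ n≡ → 1 , 2 , inj₁ refl , n≡)

-- Rectangles under Pawn.

RectangleRank : 𝕐⁺ → ℕ → Set
RectangleRank p n = ∃[ r ] parts (partition p) ≡ replicate (suc r) (suc n)

rectangle-rank : ∀ p → p ∈ Rectangle → ∃ (RectangleRank p)
rectangle-rank _ (suc r , suc c , _ , _ , eq) = c , r , eq

truncate-rectangle : ∀ r c → truncate 1 (replicate r (suc (suc c))) ≡ replicate r (suc c)
truncate-rectangle r c rewrite map-replicate (_∸ 1) r (suc (suc c)) =
  filter-all (_>? 0) (All.replicate⁺ r z<s)

truncate-column : ∀ r → truncate 1 (replicate r 1) ≡ []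
truncate-column r rewrite map-replicate (_∸ 1) r 1 =
  filter-none (_>? 0) (All.replicate⁺ r λ ())

pawn-simulates : Simulates Pawn (λ n m → n ≡ 1 + m) RectangleRank
pawn-simulates = record { forth = forth ; back = back }
  where
  -- Either Pawn move removes one column from the `r` rows that are left. If there is only one
  -- column, or no row, the result is empty and hence not a position.
  narrowed : ∀ {q n} r → parts (partition q) ≡ truncate 1 (replicate r (suc n)) →
             ∃[ m ] (n ≡ 1 + m × RectangleRank q m)
  narrowed {q} {zero}  r       eq = contradiction (trans eq (truncate-column r)) (parts≢[] q)
  narrowed {q} {suc n} zero    eq = contradiction eq (parts≢[] q)
  narrowed {q} {suc n} (suc r) eq = n , refl , r , trans eq (truncate-rectangle (suc r) n)

  forth : ∀ {n} p q → RectangleRank p n → Move Pawn p q → ∃[ m ] (n ≡ 1 + m × RectangleRank q m)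
  forth p q (r , eq) (_ , _ , inj₁ refl , q≡) =
    narrowed {q} (suc r) (trans (cong parts q≡) (cong (truncate 1) eq))
  forth p q (r , eq) (_ , _ , inj₂ refl , q≡) =
    narrowed {q} r (trans (cong parts q≡) (cong (truncate 1 ∘ drop 1) eq))

  back : ∀ {n m} p → RectangleRank p n → n ≡ 1 + m → ∃[ q ] (Move Pawn p q × RectangleRank q m)
  back {m = m} p (r , eq) refl =
    mk𝕐⁺ (partition p [ 0 , 1 ]) (λ q≡[] → contradiction (trans (sym q-rank) q≡[]) λ ()) ,
    -- The move (0,1) keeps all rows, so it is available at any width above one; (1,1) would fail on
    -- a single row.
    (0 , 1 , inj₁ refl , refl) , r , q-rank
    where
    q-rank : parts (partition p [ 0 , 1 ]) ≡ replicate (suc r) (suc m)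
    q-rank = trans (cong (truncate 1) eq) (truncate-rectangle (suc r) m)

-- Diagonal shifts and Bishop.

drop-filter-positive : ∀ i {xs} → AllPairs _≥_ xs →
                       drop i (filter (_>? 0) xs) ≡ filter (_>? 0) (drop i xs)
drop-filter-positive zero    _             = refl
drop-filter-positive (suc i) []            = refl
-- After a zero, a weakly decreasing list has only zeros, so both sides are empty.
drop-filter-positive (suc i) {zero ∷ xs} (x≥ ∷ _) = trans
  (cong (drop (suc i)) (filter-none (_>? 0) (All.map ≤⇒≯ x≥)))
  (sym (filter-none (_>? 0) (All.drop⁺ i (All.map ≤⇒≯ x≥))))
drop-filter-positive (suc i) {suc x ∷ xs} (_ ∷ dec) = drop-filter-positive i dec

truncate-filter-positive : ∀ j xs → truncate j (filter (_>? 0) xs) ≡ truncate j xs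
truncate-filter-positive j []           = refl
truncate-filter-positive j (zero ∷ xs) rewrite 0∸n≡0 j = truncate-filter-positive j xs
truncate-filter-positive j (suc x ∷ xs) with (suc x ∸ j) >? 0
... | yes pos = trans (filter-accept (_>? 0) pos)
        (trans (cong (suc x ∸ j ∷_) (truncate-filter-positive j xs)) (sym (filter-accept (_>? 0) pos)))
... | no npos = trans (filter-reject (_>? 0) npos)
        (trans (truncate-filter-positive j xs) (sym (filter-reject (_>? 0) npos)))

shift-identity : ∀ p → p [ 0 , 0 ] ≡ p
shift-identity p = partition-≡ (trans (cong (filter (_>? 0)) (map-id (parts p)))
                                      (filter-all (_>? 0) (positive p)))

-- Entries filtered out by the first shift would be zero after the second one anyway, and they are
-- trailing, so they do not disturb the dropping.
shift-shift : ∀ p i j i′ j′ → p [ i , j ] [ i′ , j′ ] ≡ p [ i + i′ , j + j′ ]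
shift-shift p i j i′ j′ = partition-≡ (begin
  truncate j′ (drop i′ (filter (_>? 0) ys))
    ≡⟨ cong (truncate j′) (drop-filter-positive i′
         (AllPairs.map⁺ (AllPairs.map (∸-monoˡ-≤ j) (AllPairs.drop⁺ i (decreasing p))))) ⟩
  truncate j′ (filter (_>? 0) (drop i′ ys))
    ≡⟨ truncate-filter-positive j′ (drop i′ ys) ⟩
  truncate j′ (drop i′ ys)
    ≡⟨ cong (truncate j′) (drop-map i′ (drop i (parts p))) ⟩
  truncate j′ (map (_∸ j) (drop i′ (drop i (parts p))))
    ≡⟨ cong (truncate j′ ∘ map (_∸ j)) (drop-drop i i′ (parts p)) ⟩
  truncate j′ (map (_∸ j) zs)
    ≡⟨ cong (filter (_>? 0)) (map-∘ zs) ⟨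
  filter (_>? 0) (map (λ x → x ∸ j ∸ j′) zs)
    ≡⟨ cong (filter (_>? 0)) (map-cong (λ x → ∸-+-assoc x j j′) zs) ⟩
  truncate (j + j′) zs ∎)
  where
  open ≡-Reasoning
  ys zs : List ℕ
  ys = map (_∸ j) (drop i (parts p))
  zs = drop (i + i′) (parts p)

-- The side of the Durfee square of `p` is `n + 1`: the shift by `(k , k)` is nonempty exactly when
-- the diagonal has a cell in row `k + 1`.
record DiagonalLength (p : Partition) (n : ℕ) : Set where
  field
    inside  : ∀ {k} → k ≤ n → parts (p [ k , k ]) ≢ []
    outside : ∀ {k} → n < k → parts (p [ k , k ]) ≡ []

open DiagonalLength

diagonal-length-shift : ∀ {p n k} → DiagonalLength p n → k ≤ n → DiagonalLength (p [ k , k ]) (n ∸ k)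
diagonal-length-shift {p} {n} {k} d k≤n = record
  { inside  = λ {l} l≤ → inside d (subst (k + l ≤_) (m+[n∸m]≡n k≤n) (+-monoʳ-≤ k l≤))
                ∘ trans (cong parts (sym (shift-shift p k k l l)))
  ; outside = λ {l} <l → trans (cong parts (shift-shift p k k l l))
                (outside d (subst (_< k + l) (m+[n∸m]≡n k≤n) (+-monoʳ-< k <l)))
  }

-- Each shift by (1,1) removes one cell of the diagonal. The recursion is on the number of parts,
-- since the first part is dropped and filtering adds none.
diagonal-length : ∀ p → parts p ≢ [] → ∃ (DiagonalLength p)
diagonal-length p = go p (<-wellFounded _)
  where
  shift-shorter : ∀ p → parts p ≢ [] → length (parts (p [ 1 , 1 ])) < length (parts p)
  shift-shorter (mkPartition []       _ _) ≢[] = contradiction refl ≢[]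
  shift-shorter (mkPartition (x ∷ xs) _ _) _   =
    s≤s (≤-trans (length-filter (_>? 0) (map (_∸ 1) xs)) (≤-reflexive (length-map (_∸ 1) xs)))

  go : ∀ p → Acc _<_ (length (parts p)) → parts p ≢ [] → ∃ (DiagonalLength p)
  go p (acc rec) ≢[] with parts (p [ 1 , 1 ]) in eq
  ... | [] = 0 , record
    { inside  = λ { z≤n → ≢[] ∘ trans (cong parts (sym (shift-identity p))) }
    ; outside = λ { {suc k} _ → trans (cong parts (sym (shift-shift p 1 1 k k)))
                                      (cong (truncate k) (trans (cong (drop k) eq) (drop-[] k))) }
    }
  ... | _ ∷ _ with go (p [ 1 , 1 ]) (rec (shift-shorter p ≢[])) (λ eq′ → contradiction (trans (sym eq) eq′) λ ())
  ...   | n , d = suc n , record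
    { inside  = λ { {zero}  _         → ≢[] ∘ trans (cong parts (sym (shift-identity p)))
                  ; {suc k} (s≤s k≤n) → inside d k≤n ∘ trans (cong parts (shift-shift p 1 1 k k)) }
    ; outside = λ { {suc k} (s≤s n<k) → trans (cong parts (sym (shift-shift p 1 1 k k))) (outside d n<k) }
    }

DiagonalRank : 𝕐⁺ → ℕ → Set
DiagonalRank p = DiagonalLength (partition p)

bishop-simulates : Simulates Bishop _>_ DiagonalRank
bishop-simulates = record { forth = forth ; back = back }
  where
  forth : ∀ {n} p q → DiagonalRank p n → Move Bishop p q → ∃[ m ] (n > m × DiagonalRank q m)
  forth {n} p q d (_ , _ , (k , 1≤k , refl) , q≡) with k ≤? n
  ... | yes k≤n = n ∸ k , ∸-monoʳ-< 1≤k k≤n ,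
        subst (λ s → DiagonalLength s (n ∸ k)) (sym q≡) (diagonal-length-shift d k≤n)
  ... | no  k≰n = contradiction (trans (cong parts q≡) (outside d (≰⇒> k≰n))) (parts≢[] q)

  back : ∀ {n m} p → DiagonalRank p n → n > m → ∃[ q ] (Move Bishop p q × DiagonalRank q m)
  back {n} {m} p d m<n =
    mk𝕐⁺ (partition p [ n ∸ m , n ∸ m ]) (inside d (m∸n≤m n m)) ,
    -- A shift by `n ∸ m` uses up that much of the diagonal, leaving rank `n ∸ (n ∸ m)`, which is
    -- `m`.
    (_ , _ , (n ∸ m , m<n⇒0<n∸m m<n , refl) , refl) ,
    subst (DiagonalLength (partition p [ n ∸ m , n ∸ m ])) (m∸[m∸n]≡n (<⇒≤ m<n))
      (diagonal-length-shift d (m∸n≤m n m))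

theorem4p8 : (Family Pet Bishop U × Family Forced Bishop U)
    × (Family Pet Pawn Rectangle × Family Forced Pawn Rectangle)
    × (Family Pet Rook Staircase × Family Forced Rook Staircase)
    × (Family Pet Queen Staircase × Family Forced Queen Staircase)
    × (Family Pet Knight Staircase × Family Forced Knight Staircase)
theorem4p8 =
  pet×forced bishop-simulates nim
    (λ p _ → diagonal-length (partition p) (parts≢[] p)) ,
  pet×forced pawn-simulates (ladder 1) rectangle-rank ,
  pet×forced (horizontal-staircase inj₂) nim staircase-rank ,
  pet×forced (horizontal-staircase (inj₂ ∘ inj₁)) nim staircase-rank ,
  pet×forced knight-simulates (ladder 3) staircase-rank
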